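{- Let $d \ge 2$ be an integer, let $P$ be a partition of $[d]$, and let $R$ be a non-empty family of partitions of $[d]$. If $P$ is not finer than any of the partitions in $R$, then for every field $\mathbb{F}$ and every positive integer $n$ the order-$d$ tensor $\Delta_P : [n]^d \to \mathbb{F}$ has $R$-rank at least $n^{c(d)}$, where $c(d) = 3^{ -2^{d+1}}$.
   Context: $[d]=\{1,\dots,d\}$; the parts of a partition are non-empty. $\mathbb{F}$ is an arbitrary field. For positive integers $n_1,\dots,n_d$, an order-$d$ tensor is a function $T:[n_1]\times\dots\times[n_d]\to\mathbb{F}$. For $x\in[n_1]\times\dots\times[n_d]$ and $J\subset[d]$, $x(J)\in\prod_{j\in J}[n_j]$ denotes the restriction of $x$ to its coordinates in $J$. $R$-rank: let $R$ be a non-empty family of partitions of $[d]$. An order-$d$ tensor $T$ has $R$-rank at most $1$ if there exist a partition $P\in R$ and, for each $J\in P$, a function $a_J:\prod_{j\in J}[n_j]\to\mathbb{F}$ such that $T(x)=\prod_{J\in P}a_J(x(J))$ for all $x$. The $R$-rank of $T$ is the smallest nonnegative integer $k$ such that $T=T_1+\dots+T_k$ for some order-$d$ tensors $T_1,\dots,T_k$ each of $R$-rank at most $1$ (the partition used may differ from one $T_i$ to another; the zero tensor has $R$-rank $0$). Finer: for partitions $P_1,P_2$ of $[d]$, $P_2$ is finer than $P_1$ (written $P_2\prec P_1$) if for every $J_2\in P_2$ there is $J_1\in P_1$ with $J_2\subset J_1$ (so every partition is finer than itself). The tensor $\Delta_P$: for non-empty $J\subset[d]$, $\Delta_J:[n]^J\to\mathbb{F}$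 is defined by $\Delta_J(x(J))=1$ if $x_{j_1}=x_{j_2}$ for all $j_1,j_2\in J$, and $\Delta_J(x(J))=0$ otherwise (so $\Delta_J\equiv 1$ if $|J|=1$). For a partition $P$ of $[d]$, $\Delta_P:[n]^d\to\mathbb{F}$ is $\Delta_P(x_1,\dots,x_d)=\prod_{J\in P}\Delta_J(x(J))$. -}

module Defs where

open import Algebra.Apartness.Bundles using (HeytingField; HeytingCommutativeRing)
open import Algebra.Bundles using (CommutativeRing)
open import Data.Bool.Base using (if_then_else_)
open import Data.Fin.Base using (Fin; zero; suc)
open import Data.Fin.Properties using (_≟_)
open import Data.Fin.Subset using (Subset; inside; outside; ⊤; _∈_; _⊆_; _∩_; Nonempty; Empty)
open import Data.List.Base using (List; []; _∷_; map; foldr)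
open import Data.List.Relation.Unary.All using (All; all?; reduce)
open import Data.List.Relation.Unary.AllPairs using (AllPairs)
open import Data.List.Relation.Unary.Any using (Any)
open import Data.Nat.Base using (ℕ; suc; _≤_; _<_)
open import Data.Nat.Induction using (<-rec)
open import Data.Nat.Properties using (≤-refl; ≤-trans; <⇒≤; ≮⇒≥)
open import Data.Product.Base using (Σ-syntax; ∃-syntax; _×_; _,_)
open import Data.Vec.Base using ([]; _∷_)
open import Function.Base using (_∘_)
open import Level using (Level; _⊔_)
open import Relation.Binary.PropositionalEquality.Core using (_≡_)
open import Relation.Nullary.Decidable.Core using (Dec; ⌊_⌋)
open import Relation.Nullary.Negation.Core using (¬_)
open import Relation.Unary using (Pred)

-- [d] is Fin d. Blocks are listed, but nothing below depends on their order;
-- they are distinct because they are non-empty and pairwise disjoint.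
record Partition (d : ℕ) : Set where
  field
    blocks   : List (Subset d)
    nonempty : All Nonempty blocks
    disjoint : AllPairs (λ J₁ J₂ → Empty (J₁ ∩ J₂)) blocks
    covering : ∀ j → Any (j ∈_) blocks

open Partition public

infix 4 _≺_

-- P₂ ≺ P₁: P₂ is finer than P₁.
_≺_ : ∀ {d} → Partition d → Partition d → Set
P₂ ≺ P₁ = All (λ J₂ → Any (λ J₁ → J₂ ⊆ J₁) (blocks P₁)) (blocks P₂)

-- Box n J is the product of the [n j] over j ∈ J. It is an inductive type
-- rather than a type of functions so that points with the same coordinates are
-- propositionally equal without function extensionality.
data Box : ∀ {d} → (Fin d → ℕ) → Subset d → Set where
  []   : ∀ {n} → Box n []
  _∷_  : ∀ {d} {n : Fin (suc d) → ℕ} {J} →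
         Fin (n zero) → Box (n ∘ suc) J → Box n (inside ∷ J)
  skip : ∀ {d} {n : Fin (suc d) → ℕ} {J} →
         Box (n ∘ suc) J → Box n (outside ∷ J)

Point : ∀ {d} → (Fin d → ℕ) → Set
Point n = Box n ⊤

-- restrict J x is x(J).
restrict : ∀ {d} {n : Fin d → ℕ} (J : Subset d) → Point n → Box n J
restrict []            []       = []
restrict (inside  ∷ J) (i ∷ x) = i ∷ restrict J x
restrict (outside ∷ J) (i ∷ x) = skip (restrict J x)

coordinates : ∀ {d n} {J : Subset d} → Box (λ _ → n) J → List (Fin n)
coordinates []       = []
coordinates (i ∷ y)  = i ∷ coordinates y
coordinates (skip y) = coordinates y

AllEqual : ∀ {n} → List (Fin n) → Set
AllEqual is = All (λ i₁ → All (λ i₂ → i₁ ≡ i₂) is) is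

allEqual? : ∀ {n} (is : List (Fin n)) → Dec (AllEqual is)
allEqual? is = all? (λ i₁ → all? (λ i₂ → i₁ ≟ i₂) is) is

-- A Heyting field is classically the same thing as a field, the apartness _#_
-- being the negation of _≈_.
module _ {c ℓ₁ ℓ₂ : Level} (𝔽 : HeytingField c ℓ₁ ℓ₂) where

  open HeytingField 𝔽 using (heytingCommutativeRing)
  open HeytingCommutativeRing heytingCommutativeRing using (commutativeRing)
  open CommutativeRing commutativeRing
    using (Carrier; _≈_; _*_; 0#; 1#; +-commutativeMonoid)
  open import Algebra.Properties.CommutativeMonoid.Sum +-commutativeMonoid using (sum)

  Tensor : ∀ {d} → (Fin d → ℕ) → Set c
  Tensor n = Point n → Carrier

  product : List Carrier → Carrier
  product = foldr _*_ 1#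

  module _ {d : ℕ} {ρ : Level} (R : Pred (Partition d) ρ) {n : Fin d → ℕ} where

    RRank≤1 : Tensor n → Set (c ⊔ ℓ₁ ⊔ ρ)
    RRank≤1 T =
      ∃[ Q ] R Q × Σ[ a ∈ All (λ J → Box n J → Carrier) (blocks Q) ]
        (∀ x → T x ≈ product (reduce (λ {J} a_J → a_J (restrict J x)) a))

    SumOfRRank≤1 : Tensor n → ℕ → Set (c ⊔ ℓ₁ ⊔ ρ)
    SumOfRRank≤1 T k =
      Σ[ S ∈ (Fin k → Tensor n) ] (∀ i → RRank≤1 (S i)) ×
        (∀ x → T x ≈ sum (λ i → S i x))

    -- IsRRank T r: the R-rank of T is r.
    IsRRank : Tensor n → ℕ → Set (c ⊔ ℓ₁ ⊔ ρ)
    IsRRank T r = SumOfRRank≤1 T r × (∀ k → SumOfRRank≤1 T k → r ≤ k)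

    -- The least length of a decomposition exists only up to double negation
    -- constructively. That is enough to transfer any lower bound on the R-rank
    -- which is a decidable statement to the lengths of all decompositions.
    ¬¬-rank : ∀ {T k} → SumOfRRank≤1 T k → ¬ ¬ (∃[ r ] r ≤ k × IsRRank T r)
    ¬¬-rank {T} {k} = <-rec Goal step k
      where
      Goal : ℕ → Set (c ⊔ ℓ₁ ⊔ ρ)
      Goal k = SumOfRRank≤1 T k → ¬ ¬ (∃[ r ] r ≤ k × IsRRank T r)

      step : ∀ k → (∀ {m} → m < k → Goal m) → Goal k
      step k ih s none = none (k , ≤-refl , s , λ m t → ≮⇒≥ λ m<k →
        ih m<k t λ (r , r≤m , isRank) → none (r , ≤-trans r≤m (<⇒≤ m<k) , isRank))

  ΔBlock : ∀ {d n} (J : Subset d) → Box (λ _ → n) J → Carrier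
  ΔBlock J y = if ⌊ allEqual? (coordinates y) ⌋ then 1# else 0#

  Δ : ∀ {d} → Partition d → (n : ℕ) → Tensor {d} (λ _ → n)
  Δ P n x = product (map (λ J → ΔBlock J (restrict J x)) (blocks P))

{-# OPTIONS --safe #-}
-- Every tensor of R-rank at most 1 is a product of a function of the coordinates
-- in I and a function of those outside I, for some I splitting a block of P.
-- Contracting a block J with weights u_j on its coordinates, all but one of
-- which come from Gaussian elimination while the last is a point mass, kills any
-- given family of fewer than n / d such products split at J, and leaves
-- the others products. If the coordinates outside J are confined to a grid so
-- small that its points number fewer than n / (d r), then all terms splitting J
-- are killed at all points of the grid at once, whereas Δ_P turns into the
-- corresponding tensor for P without J. Contracting one block after
-- another on rapidly shrinking grids leaves 1 = 0.

module Submission where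

open import Defs
open import Algebra.Apartness.Bundles using (HeytingField; HeytingCommutativeRing)
open import Algebra.Bundles using (CommutativeRing)
open import Data.Bool.Base using (Bool; true; false; not; if_then_else_)
import Data.Bool.Properties as Bool
open import Data.Bool.Properties using (¬-not; not-¬)
open import Data.Empty using (⊥; ⊥-elim)
open import Data.Fin.Base using (Fin; zero; suc; inject≤; combine; remQuot; punchIn; finToFun; funToFin)
open import Data.Fin.Properties
  using (_≟_; ¬∀⟶∃¬; injective⇒≤; inject≤-injective; punchInᵢ≢i; remQuot-combine; finToFun-funToFin)
open import Data.Fin.Subset using (Subset; Empty; _⊆_; _∩_) renaming (_∈_ to _∈ˢ_)
open import Data.Fin.Subset.Properties using (_∈?_; _⊆?_; x∈p∩q⁺; x∈p∩q⁻)
import Data.List.Base as List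
open import Data.List.Base using (List; []; _∷_; length; filter; allFin; map; _++_)
open import Data.List.Membership.Propositional using (_∉_; find; lose) renaming (_∈_ to _∈ₗ_)
open import Data.List.Membership.Propositional.Properties using (∈-filter⁺; ∈-filter⁻; ∈-allFin; ∈-lookup)
open import Data.List.Properties using (length-filter; length-tabulate; length-++)
import Data.List.Relation.Unary.All as All
open import Data.List.Relation.Unary.All using (All; []; _∷_)
open import Data.List.Relation.Unary.All.Properties using (¬All⇒Any¬)
open import Data.List.Relation.Unary.AllPairs using (AllPairs; []; _∷_)
import Data.List.Relation.Unary.Any as Any
open import Data.List.Relation.Unary.Any using (Any; here; there)
import Data.List.Relation.Unary.Any.Properties as Any
open import Data.List.Relation.Unary.Unique.Propositional using (Unique)
import Data.List.Relation.Unary.Unique.Propositional.Properties as Unique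
open import Data.Nat.Base using (ℕ; zero; suc; NonZero; _+_; _*_; _^_; _≤_; _<_; z≤n; s≤s)
import Data.Nat.Properties as ℕ
open import Data.Product.Base using (Σ-syntax; ∃; ∃₂; ∃-syntax; _×_; _,_; proj₁; proj₂; map₂)
open import Data.Sum.Base using (_⊎_; inj₁; inj₂)
open import Data.Unit.Base using (⊤; tt)
import Data.Vec.Base as Vec
open import Data.Vec.Base using (Vec; []; _∷_; here; there; lookup; replicate; tabulate; _[_]≔_)
open import Data.Vec.Properties
  using (lookup∘update; lookup∘update′; lookup-map; lookup-replicate; lookup∘tabulate;
         []=⇒lookup; lookup⇒[]=; tabulate-cong; tabulate∘lookup)
open import Function.Base using (_∘_; id; case_of_)
open import Level using (Level; Lift; _⊔_)
open import Relation.Binary.PropositionalEquality as ≡ using (_≡_; _≢_; cong; subst)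
open import Relation.Nullary.Decidable using (does; yes; no; dec-true; dec-false; _×-dec_; _→-dec_; ¬?; decidable-stable)
open import Relation.Nullary.Negation.Core using (¬_; contradiction)
open import Relation.Unary using (Pred; Satisfiable; _∈_)

-- Updates of vectors, and the pigeonhole principle.

lookup-update-cong : ∀ {a} {A : Set a} {d} {x y : Vec A d} j s k →
  lookup x k ≡ lookup y k → lookup (x [ j ]≔ s) k ≡ lookup (y [ j ]≔ s) k
lookup-update-cong {x = x} {y} j s k x≡y with k ≟ j
... | yes ≡.refl = ≡.trans (lookup∘update j x s) (≡.sym (lookup∘update j y s))
... | no k≢j = ≡.trans (lookup∘update′ k≢j x s) (≡.trans x≡y (≡.sym (lookup∘update′ k≢j y s)))

setAll : ∀ {a} {A : Set a} {d} → List (Fin d) → A → Vec A d → Vec A d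
setAll []       s x = x
setAll (j ∷ js) s x = setAll js s x [ j ]≔ s

lookup-setAll-∈ : ∀ {a} {A : Set a} {d} {js} {s : A} {x : Vec A d} {j} →
  j ∈ₗ js → lookup (setAll js s x) j ≡ s
lookup-setAll-∈ {js = k ∷ js} {s} {x} {j} j∈ with j ≟ k
... | yes ≡.refl = lookup∘update k (setAll js s x) s
lookup-setAll-∈ {js = k ∷ js} (here j≡k) | no j≢k = contradiction j≡k j≢k
lookup-setAll-∈ {js = k ∷ js} {s} {x} (there j∈) | no j≢k =
  ≡.trans (lookup∘update′ j≢k (setAll js s x) s) (lookup-setAll-∈ j∈)

lookup-setAll-∉ : ∀ {a} {A : Set a} {d} {js} {s : A} {x : Vec A d} {j} →
  j ∉ js → lookup (setAll js s x) j ≡ lookup x j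
lookup-setAll-∉ {js = []} j∉ = ≡.refl
lookup-setAll-∉ {js = k ∷ js} {s} {x} j∉ =
  ≡.trans (lookup∘update′ (j∉ ∘ here) (setAll js s x) s) (lookup-setAll-∉ (j∉ ∘ there))

-- If nothing were missing, taking positions in the list would be an injection of `Fin m` into a
-- smaller `Fin`.
∃∉ : ∀ {m} (is : List (Fin m)) → length is < m → ∃ (_∉ is)
∃∉ {m} is is<m = ¬∀⟶∃¬ m (_∈ₗ is) (λ i → Any.any? (i ≟_) is) λ all∈ →
  ℕ.<⇒≱ is<m (injective⇒≤ {f = Any.index ∘ all∈} λ {i} {j} eq →
    ≡.trans (Any.lookup-index (all∈ i))
      (≡.trans (cong (List.lookup is) eq) (≡.sym (Any.lookup-index (all∈ j)))))

-- Numerical estimates for grid sizes and exponents.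

n<2^n : ∀ n → n < 2 ^ n
n<2^n zero    = s≤s z≤n
n<2^n (suc n) = begin-strict
  suc n            ≤⟨ n<2^n n ⟩
  2 ^ n            <⟨ ℕ.m<m+n (2 ^ n) (ℕ.≤-trans (ℕ.m^n>0 2 n) (ℕ.≤-reflexive (≡.sym (ℕ.+-identityʳ _)))) ⟩
  2 ^ suc n        ∎
  where open ℕ.≤-Reasoning

-- The side of a grid large enough for contracting k blocks, one after another.
gridSize : ℕ → ℕ → ℕ → ℕ
gridSize d r k = r ^ (suc d ^ suc k)

gridSize-mono : ∀ d {r} .{{_ : NonZero r}} k → gridSize d r k ≤ gridSize d r (suc k)
gridSize-mono d {r} k = ℕ.^-monoʳ-≤ r (ℕ.m≤n*m (suc d ^ suc k) (suc d))

-- The left side is the cost of contracting one block over the smaller grid: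
-- `r * gridSize d r k ^ d` pairs of a term and a grid point, for each of at most `d` coordinates.
-- Since `d * r` is below `r ^ e`, the exponent `e + e * d` suffices, which is the next power of
-- `suc d`.
gridSize-suc : ∀ d {r} → 2 ≤ r → ∀ k → d * (r * gridSize d r k ^ d) < gridSize d r (suc k)
gridSize-suc d {suc r-1} 2≤r k = begin-strict
  d * (r * gridSize d r k ^ d)   ≡⟨ ℕ.*-assoc d r _ ⟨
  d * r * gridSize d r k ^ d     ≡⟨ cong (d * r *_) (ℕ.^-*-assoc r e d) ⟩
  d * r * r ^ (e * d)            <⟨ ℕ.*-monoˡ-< (r ^ (e * d)) {{ℕ.m^n≢0 r (e * d)}} dr<rᵉ ⟩
  r ^ e * r ^ (e * d)            ≡⟨ ℕ.^-distribˡ-+-* r e (e * d) ⟨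
  r ^ (e + e * d)                ≡⟨ cong (λ ed → r ^ (e + ed)) (ℕ.*-comm e d) ⟩
  gridSize d r (suc k)           ∎
  where
  open ℕ.≤-Reasoning
  r e : ℕ
  r = suc r-1
  e = suc d ^ suc k
  dr<rᵉ : d * r < r ^ e
  dr<rᵉ = begin-strict
    d * r          ≡⟨ ℕ.*-comm d r ⟩
    r * d          <⟨ ℕ.*-monoʳ-< r (ℕ.<-≤-trans (n<2^n d) (ℕ.^-monoˡ-≤ d 2≤r)) ⟩
    r ^ suc d      ≤⟨ ℕ.^-monoʳ-≤ r (ℕ.m≤m*n (suc d) (suc d ^ k) {{ℕ.m^n≢0 (suc d) k}}) ⟩
    r ^ e          ∎

-- Passing from `d` to `suc d` multiplies the left side by (d + 2) / d, which is at most 2 once `d`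
-- is at least 2.
d*1+d≤2^1+d : ∀ {d} → 2 ≤ d → d * suc d ≤ 2 ^ suc d
d*1+d≤2^1+d {1}                 (s≤s ())
d*1+d≤2^1+d {2}                 2≤d = ℕ.m≤m+n 6 2
d*1+d≤2^1+d {suc d@(suc (suc _))} 2≤1+d = begin
  suc d * suc (suc d)            ≤⟨ ℕ.*-monoʳ-≤ (suc d) (s≤s (s≤s (ℕ.m≤n+m d _))) ⟩
  suc d * (d + d)                ≡⟨ cong (λ x → suc d * (d + x)) (ℕ.+-identityʳ d) ⟨
  suc d * (2 * d)                ≡⟨ ℕ.*-comm (suc d) (2 * d) ⟩
  2 * d * suc d                  ≡⟨ ℕ.*-assoc 2 d (suc d) ⟩
  2 * (d * suc d)                ≤⟨ ℕ.*-monoʳ-≤ 2 (d*1+d≤2^1+d {d} (s≤s (s≤s z≤n))) ⟩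
  2 ^ suc (suc d)                ∎
  where open ℕ.≤-Reasoning

-- Compares the exponent of the grid size for contracting `d` blocks with 1 / c(d), through
-- `suc d ≤ 2 ^ d ≤ 3 ^ d`.
exponent-bound : ∀ {d} → 2 ≤ d → suc d ^ suc d ≤ 3 ^ (2 ^ (d + 1))
exponent-bound {d} 2≤d = begin
  suc d ^ suc d        ≤⟨ ℕ.^-monoˡ-≤ (suc d) (ℕ.≤-trans (n<2^n d) (ℕ.^-monoˡ-≤ d (ℕ.n≤1+n 2))) ⟩
  (3 ^ d) ^ suc d      ≡⟨ ℕ.^-*-assoc 3 d (suc d) ⟩
  3 ^ (d * suc d)      ≤⟨ ℕ.^-monoʳ-≤ 3 (d*1+d≤2^1+d 2≤d) ⟩
  3 ^ (2 ^ suc d)      ≡⟨ cong (λ e → 3 ^ (2 ^ e)) (ℕ.+-comm 1 d) ⟩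
  3 ^ (2 ^ (d + 1))    ∎
  where open ℕ.≤-Reasoning

-- Linear algebra over a Heyting field.

module _ {c ℓ₁ ℓ₂ : Level} (𝔽 : HeytingField c ℓ₁ ℓ₂) where

  open HeytingField 𝔽 using (heytingCommutativeRing; tight; _#_; #⇒invertible; #-irrefl; invertible⇒#)
  open HeytingCommutativeRing heytingCommutativeRing using (commutativeRing)
  open CommutativeRing commutativeRing hiding (zero; _+_; _*_)
  open CommutativeRing commutativeRing using () renaming (_+_ to _⊕_; _*_ to _⊛_)
  open import Algebra.Properties.Semiring.Sum semiring
    using (sum; sum-cong-≋; sum-remove; sum-replicate-zero; ∑-distrib-+; ∑-comm; *-distribˡ-sum; *-distribʳ-sum)
  open import Algebra.Properties.Ring ring using (-‿distribˡ-*; -0#≈0#)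
  open import Relation.Binary.Reasoning.Setoid setoid

  -- The difference of 1 and 0 has inverse 1, so the two are apart, and apartness is irreflexive.
  0≉1 : ¬ 0# ≈ 1#
  0≉1 0≈1 = #-irrefl (sym 0≈1) (invertible⇒# (1# , 1-0 , 1-0′))
    where
    1-0 : 1# ⊛ (1# - 0#) ≈ 1#
    1-0 = trans (*-identityˡ _) (trans (+-congˡ -0#≈0#) (+-identityʳ _))
    1-0′ : (1# - 0#) ⊛ 1# ≈ 1#
    1-0′ = trans (*-comm _ _) 1-0

  sum-zero : ∀ {m} {f : Fin m → Carrier} → (∀ i → f i ≈ 0#) → sum f ≈ 0#
  sum-zero {m} f≈0 = trans (sum-cong-≋ f≈0) (sum-replicate-zero m)

  sum-single : ∀ {m} {f : Fin m → Carrier} i → (∀ k → k ≢ i → f k ≈ 0#) → sum f ≈ f i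
  sum-single {suc m} {f} i f≈0 = begin
    sum f                                ≈⟨ sum-remove f ⟩
    f i ⊕ sum (λ k → f (punchIn i k))    ≈⟨ +-congˡ (sum-zero λ k → f≈0 _ (punchInᵢ≢i i k)) ⟩
    f i ⊕ 0#                             ≈⟨ +-identityʳ _ ⟩
    f i                                  ∎

  infix 8 _∙_
  _∙_ : ∀ {m} → (Fin m → Carrier) → (Fin m → Carrier) → Carrier
  u ∙ h = sum λ s → u s ⊛ h s

  -- The weight 1 off the few pivots is what later keeps the tensor itself alive: its surviving
  -- entry sits at a point that is no pivot.
  Annihilator : ∀ {N m} → (Fin N → Fin m → Carrier) → Set (c ⊔ ℓ₁)
  Annihilator {N} {m} ℓ = Σ[ u ∈ (Fin m → Carrier) ] Σ[ pivots ∈ List (Fin m) ]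
    length pivots ≤ N × (∀ s → s ∉ pivots → u s ≈ 1#) × (∀ i → u ∙ ℓ i ≈ 0#)

  -- Apartness need not be decidable, hence the double negation; by tightness an entry not apart
  -- from 0 equals 0. This is enough, as the weights only serve to derive a contradiction.
  zero-or-apart : ∀ {m} (h : Fin m → Carrier) → ¬ ¬ ((∀ s → h s ≈ 0#) ⊎ ∃[ s ] h s # 0#)
  zero-or-apart h k = k (inj₁ λ s → proj₁ (tight _ _) λ hs#0 → k (inj₂ (s , hs#0)))

  #0⇒inverse : ∀ {x} → x # 0# → ∃[ v ] v ⊛ x ≈ 1#
  #0⇒inverse x#0 with #⇒invertible x#0
  ... | v , vx≈1 , _ = v , trans (*-congˡ (sym (trans (+-congˡ -0#≈0#) (+-identityʳ _)))) vx≈1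

  -- Gaussian elimination, with every free variable set to 1.
  annihilator : ∀ {N m} (ℓ : Fin N → Fin m → Carrier) → ¬ ¬ Annihilator ℓ
  annihilator {zero} ℓ k = k ((λ _ → 1#) , [] , z≤n , (λ _ _ → refl) , λ ())
  annihilator {suc N} {m} ℓ k = zero-or-apart (ℓ zero) λ where
    (inj₁ ℓ₀≈0) → annihilator (ℓ ∘ suc) λ (u , pivots , ≤N , one , kills) →
      k (u , pivots , ℕ.m≤n⇒m≤1+n ≤N , one , λ where
        zero    → sum-zero λ s → trans (*-congˡ (ℓ₀≈0 s)) (zeroʳ _)
        (suc i) → kills i)
    (inj₂ (p , ℓ₀p#0)) →
      let (v , vℓ₀p≈1) = #0⇒inverse ℓ₀p#0 in
      -- These multiples of `ℓ zero` cancel the entries at `p`, so changing the weight at `p`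
      -- afterwards does not disturb the reduced vectors.
      annihilator (λ i s → ℓ (suc i) s ⊕ (- (ℓ (suc i) p ⊛ v)) ⊛ ℓ zero s)
        λ (u , pivots , ≤N , one , kills) → k (extend v vℓ₀p≈1 u pivots ≤N one kills)
      where
      module _ {p : Fin m} (v : Carrier) (vℓ₀p≈1 : v ⊛ ℓ zero p ≈ 1#) where
        κ : Fin N → Carrier
        κ i = - (ℓ (suc i) p ⊛ v)

        extend : ∀ u pivots → length pivots ≤ N → (∀ s → s ∉ pivots → u s ≈ 1#) →
          (∀ i → u ∙ (λ s → ℓ (suc i) s ⊕ κ i ⊛ ℓ zero s) ≈ 0#) → Annihilator ℓ
        extend u pivots ≤N one kills = u′ , p ∷ pivots , s≤s ≤N , one′ , kills′
          where
          e w : Carrier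
          e = u ∙ ℓ zero
          -- Cancels the value `e` that `u` still has on `ℓ zero`, because `v` inverts the entry at
          -- `p`.
          w = - (e ⊛ v)

          δ : Fin m → Carrier
          δ s = if does (s ≟ p) then w else 0#

          u′ : Fin m → Carrier
          u′ s = u s ⊕ δ s

          δ-off : ∀ s → s ≢ p → δ s ≈ 0#
          δ-off s s≢p rewrite dec-false (s ≟ p) s≢p = refl

          δ-on : δ p ≈ w
          δ-on rewrite dec-true (p ≟ p) ≡.refl = refl

          one′ : ∀ s → s ∉ p ∷ pivots → u′ s ≈ 1#
          one′ s s∉ = trans (+-cong (one s (s∉ ∘ there)) (δ-off s (s∉ ∘ here))) (+-identityʳ _)

          u′∙ : ∀ h → u′ ∙ h ≈ u ∙ h ⊕ w ⊛ h p
          u′∙ h = begin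
            u′ ∙ h                              ≈⟨ sum-cong-≋ (λ s → distribʳ (h s) (u s) (δ s)) ⟩
            sum (λ s → u s ⊛ h s ⊕ δ s ⊛ h s)   ≈⟨ ∑-distrib-+ (λ s → u s ⊛ h s) (λ s → δ s ⊛ h s) ⟩
            u ∙ h ⊕ δ ∙ h                       ≈⟨ +-congˡ (sum-single p λ s s≢p → trans (*-congʳ (δ-off s s≢p)) (zeroˡ _)) ⟩
            u ∙ h ⊕ δ p ⊛ h p                   ≈⟨ +-congˡ (*-congʳ δ-on) ⟩
            u ∙ h ⊕ w ⊛ h p                     ∎

          u∙reduced : ∀ i → u ∙ (λ s → ℓ (suc i) s ⊕ κ i ⊛ ℓ zero s) ≈ u ∙ ℓ (suc i) ⊕ κ i ⊛ e
          u∙reduced i = begin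
            u ∙ (λ s → ℓ (suc i) s ⊕ κ i ⊛ ℓ zero s)
              ≈⟨ sum-cong-≋ (λ s → distribˡ (u s) _ _) ⟩
            sum (λ s → u s ⊛ ℓ (suc i) s ⊕ u s ⊛ (κ i ⊛ ℓ zero s))
              ≈⟨ ∑-distrib-+ (λ s → u s ⊛ ℓ (suc i) s) (λ s → u s ⊛ (κ i ⊛ ℓ zero s)) ⟩
            u ∙ ℓ (suc i) ⊕ sum (λ s → u s ⊛ (κ i ⊛ ℓ zero s))
              ≈⟨ +-congˡ (sum-cong-≋ λ s → x*yz≈y*xz (u s) (κ i) (ℓ zero s)) ⟩
            u ∙ ℓ (suc i) ⊕ sum (λ s → κ i ⊛ (u s ⊛ ℓ zero s))
              ≈⟨ +-congˡ (sym (*-distribˡ-sum (κ i) λ s → u s ⊛ ℓ zero s)) ⟩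
            u ∙ ℓ (suc i) ⊕ κ i ⊛ e ∎
            where
            x*yz≈y*xz : ∀ x y z → x ⊛ (y ⊛ z) ≈ y ⊛ (x ⊛ z)
            x*yz≈y*xz x y z = trans (sym (*-assoc x y z)) (trans (*-congʳ (*-comm x y)) (*-assoc y x z))

          swap : ∀ x → w ⊛ x ≈ (- (x ⊛ v)) ⊛ e
          swap x = begin
            (- (e ⊛ v)) ⊛ x   ≈⟨ -‿distribˡ-* _ _ ⟨
            - ((e ⊛ v) ⊛ x)   ≈⟨ -‿cong (trans (*-comm _ _) (trans (*-congˡ (*-comm e v)) (sym (*-assoc x v e)))) ⟩
            - ((x ⊛ v) ⊛ e)   ≈⟨ -‿distribˡ-* _ _ ⟩
            (- (x ⊛ v)) ⊛ e   ∎

          kills′ : ∀ i → u′ ∙ ℓ i ≈ 0#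
          kills′ zero = begin
            u′ ∙ ℓ zero                    ≈⟨ u′∙ (ℓ zero) ⟩
            e ⊕ (- (e ⊛ v)) ⊛ ℓ zero p     ≈⟨ +-congˡ (-‿distribˡ-* _ _) ⟨
            e ⊕ - ((e ⊛ v) ⊛ ℓ zero p)     ≈⟨ +-congˡ (-‿cong (trans (*-assoc _ _ _) (trans (*-congˡ vℓ₀p≈1) (*-identityʳ e)))) ⟩
            e ⊕ - e                        ≈⟨ -‿inverseʳ e ⟩
            0#                             ∎
          kills′ (suc i) = begin
            u′ ∙ ℓ (suc i)                     ≈⟨ u′∙ (ℓ (suc i)) ⟩
            -- The correction at `p` contributes exactly what the subtracted multiple of `ℓ zero`
            -- did.
            u ∙ ℓ (suc i) ⊕ w ⊛ ℓ (suc i) p    ≈⟨ +-congˡ (swap _) ⟩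
            u ∙ ℓ (suc i) ⊕ κ i ⊛ e            ≈⟨ u∙reduced i ⟨
            u ∙ (λ s → ℓ (suc i) s ⊕ κ i ⊛ ℓ zero s) ≈⟨ kills i ⟩
            0#                                 ∎

  -- Terms with two factors, and their contraction by weights.

  -- Stands for the product of two factors; side j says which of them may depend on coordinate j.
  record Term (d m : ℕ) : Set (c ⊔ ℓ₁) where
    field
      side   : Fin d → Bool
      factor : Bool → Vec (Fin m) d → Carrier
      local  : ∀ b {x y} → (∀ j → side j ≡ b → lookup x j ≡ lookup y j) → factor b x ≈ factor b y

    value : Vec (Fin m) d → Carrier
    value x = factor true x ⊛ factor false x

    value-zero : ∀ b {x} → factor b x ≈ 0# → value x ≈ 0#
    value-zero true  f≈0 = trans (*-congʳ f≈0) (zeroˡ _)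
    value-zero false f≈0 = trans (*-congˡ f≈0) (zeroʳ _)

  open Term

  module _ {d m : ℕ} where

    Weights : List (Fin d) → Set c
    Weights = All λ _ → Fin m → Carrier

    contractAt : Fin d → (Fin m → Carrier) → (Vec (Fin m) d → Carrier) → Vec (Fin m) d → Carrier
    contractAt j u f x = u ∙ λ s → f (x [ j ]≔ s)

    contract : ∀ {js} → Weights js → (Vec (Fin m) d → Carrier) → Vec (Fin m) d → Carrier
    contract []             f = f
    contract (_∷_ {j} u us) f = contract us (contractAt j u f)

    -- `side` stays unchanged although the summed factor no longer depends on `j`; which blocks a
    -- term splits thus remains readable after contraction.
    contractTermAt : Fin d → (Fin m → Carrier) → Term d m → Term d m
    contractTermAt j u t .side = side t
    contractTermAt j u t .factor b =
      if does (side t j Bool.≟ b) then contractAt j u (factor t b) else factor t b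
    contractTermAt j u t .local b {x} {y} agree with side t j Bool.≟ b
    ... | yes _ = sum-cong-≋ λ s → *-congˡ (local t b λ k side≡ → lookup-update-cong {x = x} {y = y} j s k (agree k side≡))
    ... | no  _ = local t b agree

    contractTerm : ∀ {js} → Weights js → Term d m → Term d m
    contractTerm []             t = t
    contractTerm (_∷_ {j} u us) t = contractTerm us (contractTermAt j u t)

    side-contractTerm : ∀ {js} (us : Weights js) t → side (contractTerm us t) ≡ side t
    side-contractTerm []       t = ≡.refl
    side-contractTerm (u ∷ us) t = side-contractTerm us _

    factor-contractTerm-∉ : ∀ {js} (us : Weights js) t b → (∀ j → j ∈ₗ js → side t j ≢ b) →
      factor (contractTerm us t) b ≡ factor t b
    factor-contractTerm-∉ [] t b off = ≡.refl
    factor-contractTerm-∉ (_∷_ {j} u us) t b off =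
      ≡.trans (factor-contractTerm-∉ us (contractTermAt j u t) b (λ k → off k ∘ there))
        (cong (if_then contractAt j u (factor t b) else factor t b)
          (dec-false (side t j Bool.≟ b) (off j (here ≡.refl))))

    -- A contraction at `x` evaluates its argument only at points reached from `x` by changing
    -- coordinates in `js`.
    contract-cong : ∀ {p} {js} (us : Weights js) (S : Pred (Vec (Fin m) d) p) →
      (∀ x j s → j ∈ₗ js → S x → S (x [ j ]≔ s)) →
      ∀ {f g} → (∀ x → S x → f x ≈ g x) → ∀ x → S x → contract us f x ≈ contract us g x
    contract-cong []             S closed f≈g = f≈g
    contract-cong (_∷_ {j} u us) S closed f≈g =
      contract-cong us S (λ x k s → closed x k s ∘ there)
        λ x Sx → sum-cong-≋ λ s → *-congˡ (f≈g _ (closed x j s (here ≡.refl) Sx))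

    contract-cong′ : ∀ {js} (us : Weights js) {f g} → (∀ x → f x ≈ g x) → ∀ x → contract us f x ≈ contract us g x
    contract-cong′ us f≈g x = contract-cong us (λ _ → ⊤) _ (λ y _ → f≈g y) x tt

    contract-zero : ∀ {js} (us : Weights js) x → contract us (λ _ → 0#) x ≈ 0#
    contract-zero []       x = refl
    contract-zero (u ∷ us) x =
      trans (contract-cong′ us (λ y → sum-zero {f = λ s → u s ⊛ 0#} λ s → zeroʳ (u s)) x) (contract-zero us x)

    contract-sum : ∀ {js} (us : Weights js) {r} (f : Fin r → Vec (Fin m) d → Carrier) x →
      contract us (λ y → sum λ i → f i y) x ≈ sum λ i → contract us (f i) x
    contract-sum []             f x = refl
    contract-sum (_∷_ {j} u us) f x =
      trans (contract-cong′ us (λ y → trans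
        (sum-cong-≋ λ s → *-distribˡ-sum (u s) λ i → f i (y [ j ]≔ s))
        (∑-comm λ s i → u s ⊛ f i (y [ j ]≔ s))) x)
        (contract-sum us (λ i → contractAt j u (f i)) x)

    -- The factor on the other side from `j` is constant along `j` and leaves the sum.
    contractAt-value : ∀ j u t x → contractAt j u (value t) x ≈ value (contractTermAt j u t) x
    contractAt-value j u t x with side t j in eq
    ... | true = begin
      sum (λ s → u s ⊛ (factor t true (x [ j ]≔ s) ⊛ factor t false (x [ j ]≔ s)))
        ≈⟨ sum-cong-≋ (λ s → trans (*-congˡ (*-congˡ (unchanged s))) (sym (*-assoc _ _ _))) ⟩
      sum (λ s → u s ⊛ factor t true (x [ j ]≔ s) ⊛ factor t false x)
        ≈⟨ *-distribʳ-sum (factor t false x) (λ s → u s ⊛ factor t true (x [ j ]≔ s)) ⟨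
      contractAt j u (factor t true) x ⊛ factor t false x ∎
      where
      unchanged : ∀ s → factor t false (x [ j ]≔ s) ≈ factor t false x
      unchanged s = local t false λ k side≡ →
        lookup∘update′ (λ { ≡.refl → case ≡.trans (≡.sym eq) side≡ of λ () }) x s
    ... | false = begin
      sum (λ s → u s ⊛ (factor t true (x [ j ]≔ s) ⊛ factor t false (x [ j ]≔ s)))
        ≈⟨ sum-cong-≋ (λ s → rearrange (u s) _ _ _ (unchanged s)) ⟩
      sum (λ s → factor t true x ⊛ (u s ⊛ factor t false (x [ j ]≔ s)))
        ≈⟨ *-distribˡ-sum (factor t true x) (λ s → u s ⊛ factor t false (x [ j ]≔ s)) ⟨
      factor t true x ⊛ contractAt j u (factor t false) x ∎
      where
      unchanged : ∀ s → factor t true (x [ j ]≔ s) ≈ factor t true x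
      unchanged s = local t true λ k side≡ →
        lookup∘update′ (λ { ≡.refl → case ≡.trans (≡.sym eq) side≡ of λ () }) x s
      rearrange : ∀ a b b′ z → b ≈ b′ → a ⊛ (b ⊛ z) ≈ b′ ⊛ (a ⊛ z)
      rearrange a b b′ z b≈b′ = trans (*-congˡ (*-congʳ b≈b′))
        (trans (sym (*-assoc a b′ z)) (trans (*-congʳ (*-comm a b′)) (*-assoc b′ a z)))

    contract-value : ∀ {js} (us : Weights js) t x → contract us (value t) x ≈ value (contractTerm us t) x
    contract-value []             t x = refl
    contract-value (_∷_ {j} u us) t x =
      trans (contract-cong′ us (contractAt-value j u t) x) (contract-value us (contractTermAt j u t) x)

    OneAt : ∀ {js} → Fin m → Weights js → Set ℓ₁
    OneAt s []       = Lift _ ⊤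
    OneAt s (u ∷ us) = u s ≈ 1# × OneAt s us

    -- With coordinate `j₀` pinned to `s₀`, each sum retains only its summand at `s₀`, whose weight
    -- is 1, so contracting amounts to substituting `s₀`. As `j₀` is not in `js`, no sum moves the
    -- pinned coordinate.
    contract-diagonal : ∀ {js} (us : Weights js) → Unique js → ∀ {j₀ s₀} → j₀ ∉ js → OneAt s₀ us → ∀ {f} →
      (∀ x j → j ∈ₗ js → lookup x j₀ ≡ s₀ → lookup x j ≢ s₀ → f x ≈ 0#) →
      ∀ x → lookup x j₀ ≡ s₀ → contract us f x ≈ f (setAll js s₀ x)
    contract-diagonal []  unique j₀∉ one vanish x x₀≡ = refl
    contract-diagonal {j ∷ js} (u ∷ us) (j∉ ∷ unique) {j₀} {s₀} j₀∉ (u≈1 , one) {f} vanish x x₀≡ = begin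
      contract us (contractAt j u f) x              ≈⟨ contract-cong us (λ y → lookup y j₀ ≡ s₀) closed only-s₀ x x₀≡ ⟩
      contract us (λ y → f (y [ j ]≔ s₀)) x         ≈⟨ contract-diagonal us unique (j₀∉ ∘ there) one vanish′ x x₀≡ ⟩
      f (setAll js s₀ x [ j ]≔ s₀)                  ∎
      where
      update-j₀ : ∀ {k} y s → j₀ ≢ k → lookup y j₀ ≡ s₀ → lookup (y [ k ]≔ s) j₀ ≡ s₀
      update-j₀ y s j₀≢k y₀≡ = ≡.trans (lookup∘update′ j₀≢k y s) y₀≡
      closed : ∀ y k s → k ∈ₗ js → lookup y j₀ ≡ s₀ → lookup (y [ k ]≔ s) j₀ ≡ s₀
      closed y k s k∈ = update-j₀ y s λ { ≡.refl → j₀∉ (there k∈) }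
      only-s₀ : ∀ y → lookup y j₀ ≡ s₀ → contractAt j u f y ≈ f (y [ j ]≔ s₀)
      only-s₀ y y₀≡ = trans
        (sum-single s₀ λ s s≢s₀ → trans (*-congˡ (vanish (y [ j ]≔ s) j (here ≡.refl)
          (update-j₀ y s (j₀∉ ∘ here) y₀≡) (s≢s₀ ∘ ≡.trans (≡.sym (lookup∘update j y s))))) (zeroʳ _))
        (trans (*-congʳ u≈1) (*-identityˡ _))
      vanish′ : ∀ y k → k ∈ₗ js → lookup y j₀ ≡ s₀ → lookup y k ≢ s₀ → f (y [ j ]≔ s₀) ≈ 0#
      vanish′ y k k∈ y₀≡ yₖ≢ = vanish (y [ j ]≔ s₀) k (there k∈) (update-j₀ y s₀ (j₀∉ ∘ here) y₀≡)
        (yₖ≢ ∘ ≡.trans (≡.sym (lookup∘update′ (λ k≡j → All.lookup j∉ k∈ (≡.sym k≡j)) y s₀)))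

    -- Each factor is killed by the weight of the last coordinate of js on which it depends.
    killing-weights : ∀ {N} js (t : Fin N → Term d m) (b : Fin N → Bool) (x : Fin N → Vec (Fin m) d) →
      ¬ ¬ (Σ[ us ∈ Weights js ] Σ[ pivots ∈ List (Fin m) ] length pivots ≤ length js * N ×
        (∀ s → s ∉ pivots → OneAt s us) ×
        (∀ i j → j ∈ₗ js → side (t i) j ≡ b i → factor (contractTerm us (t i)) (b i) (x i) ≈ 0#))
    killing-weights [] t b x k = k ([] , [] , z≤n , _ , λ _ _ ())
    killing-weights {N} (j ∷ js) t b x k =
      annihilator (λ i s → factor (t i) (b i) (x i [ j ]≔ s)) λ (u , pivots₁ , ≤₁ , one₁ , kills₁) →
      -- The remaining weights are chosen after `u`, for the terms already contracted at `j`.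
      killing-weights js (contractTermAt j u ∘ t) b x λ (us , pivots₂ , ≤₂ , one₂ , kills₂) →
      k (u ∷ us , pivots₁ ++ pivots₂
        , subst (_≤ N + length js * N) (≡.sym (length-++ pivots₁)) (ℕ.+-mono-≤ ≤₁ ≤₂)
        , (λ s s∉ → one₁ s (s∉ ∘ Any.++⁺ˡ) , one₂ s (s∉ ∘ Any.++⁺ʳ pivots₁))
        -- If the factor depends on a later coordinate, the recursion kills it. Otherwise later
        -- contractions leave it alone, and `u` has killed it at `j`.
        , λ i j′ j′∈ side≡ → case Any.any? (λ k → side (t i) k Bool.≟ b i) js of λ where
          (yes later) → let (k′ , k′∈ , side≡′) = find later in
            kills₂ i k′ k′∈ side≡′
          (no none) → last u us i kills₁ none (first i j′ j′∈ side≡ none))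
      where
      first : ∀ i j′ → j′ ∈ₗ j ∷ js → side (t i) j′ ≡ b i → ¬ Any (λ k → side (t i) k ≡ b i) js → side (t i) j ≡ b i
      first i j′ (here ≡.refl) side≡ none = side≡
      first i j′ (there j′∈)   side≡ none = contradiction (lose j′∈ side≡) none
      last : ∀ u (us : Weights js) i → (∀ i → contractAt j u (factor (t i) (b i)) (x i) ≈ 0#) →
        ¬ Any (λ k → side (t i) k ≡ b i) js → side (t i) j ≡ b i →
        factor (contractTerm us (contractTermAt j u (t i))) (b i) (x i) ≈ 0#
      last u us i kills₁ none side≡
        rewrite factor-contractTerm-∉ us (contractTermAt j u (t i)) (b i)
                  (λ k k∈ side≡ → none (lose k∈ side≡))
              | dec-true (side (t i) j Bool.≟ b i) side≡ = kills₁ i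

  -- Contraction of one block of a partition.

  Coordinatewise : ∀ {d m m′} → (Vec (Fin m′) d → Vec (Fin m) d) → Set
  Coordinatewise {d} φ = ∀ x y j → lookup x j ≡ lookup y j → lookup (φ x) j ≡ lookup (φ y) j

  comapTerm : ∀ {d m m′} (φ : Vec (Fin m′) d → Vec (Fin m) d) → Coordinatewise φ → Term d m → Term d m′
  comapTerm φ φ-local t .side       = side t
  comapTerm φ φ-local t .factor b x = factor t b (φ x)
  comapTerm φ φ-local t .local b {x} {y} agree = local t b λ j → φ-local x y j ∘ agree j

  -- The blocks of the partition are the fibres of π.
  module _ {d s : ℕ} (π : Fin d → Fin s) (rep : Fin s → Fin d) (π-rep : ∀ J → π (rep J) ≡ J) where

    -- Together with `OneOnDiagonal` this replaces the formula of the tensor belonging to the blocks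
    -- in `Js`. Coordinates outside these blocks are unconstrained, so vectors keep length `d` while
    -- blocks are removed.
    VanishesOffDiagonal : ∀ {m} → List (Fin s) → (Vec (Fin m) d → Carrier) → Set ℓ₁
    VanishesOffDiagonal Js f = ∀ x j → π j ∈ₗ Js → lookup x j ≢ lookup x (rep (π j)) → f x ≈ 0#

    OneOnDiagonal : ∀ {m} → List (Fin s) → (Vec (Fin m) d → Carrier) → Set ℓ₁
    OneOnDiagonal Js f = ∀ x → (∀ j → π j ∈ₗ Js → lookup x j ≡ lookup x (rep (π j))) → f x ≈ 1#

    Splits : ∀ {m} → Term d m → Fin s → Set
    Splits t J = ∀ b → ∃[ j ] π j ≡ J × side t j ≡ b

    -- The invariant of successive contraction: when no block is left, every term is dead.
    DeadOrSplit : ∀ {m} → List (Fin s) → Term d m → Set ℓ₁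
    DeadOrSplit Js t = (∀ x → value t x ≈ 0#) ⊎ Any (Splits t) Js

    -- Here `m′` is the side of the grid for the coordinates outside `J`. By `large` the pivots
    -- cannot exhaust `Fin m`: there are `r * m′ ^ d` pairs of a term and a grid point, and at most
    -- `d` coordinates receive weights.
    module Step {r m m′ : ℕ} (m′≤m : m′ ≤ m) (large : d * (r * m′ ^ d) < m)
      {J : Fin s} {Js : List (Fin s)} (J∉Js : J ∉ Js)
      {f : Vec (Fin m) d → Carrier} (t : Fin r → Term d m)
      (off : VanishesOffDiagonal (J ∷ Js) f) (on : OneOnDiagonal (J ∷ Js) f)
      (f≈ : ∀ x → f x ≈ sum λ i → value (t i) x) (split : ∀ i → DeadOrSplit (J ∷ Js) (t i)) where

      ι : Fin m′ → Fin m
      ι i = inject≤ i m′≤m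

      others : List (Fin d)
      others = filter (λ j → (π j ≟ J) ×-dec ¬? (j ≟ rep J)) (allFin d)

      ∈-others : ∀ {j} → π j ≡ J → j ≢ rep J → j ∈ₗ others
      ∈-others πj≡J j≢ = ∈-filter⁺ _ (∈-allFin _) (πj≡J , j≢)

      ∉-others : ∀ {j} → π j ≢ J → j ∉ others
      ∉-others πj≢J j∈ = πj≢J (proj₁ (proj₂ (∈-filter⁻ _ {xs = allFin d} j∈)))

      rep∉others : rep J ∉ others
      rep∉others j∈ = proj₂ (proj₂ (∈-filter⁻ _ {xs = allFin d} j∈)) ≡.refl

      length-others : length others ≤ d
      length-others = ℕ.≤-trans (length-filter _ (allFin d)) (ℕ.≤-reflexive (length-tabulate id))

      -- Numbers the pairs of a term and a grid point, each of which is one condition on the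
      -- weights.
      decode : Fin (r * m′ ^ d) → Fin r × Vec (Fin m′) d
      decode = map₂ (tabulate ∘ finToFun) ∘ remQuot (m′ ^ d)

      encode : Fin r → Vec (Fin m′) d → Fin (r * m′ ^ d)
      encode i x = combine i (funToFin (lookup x))

      decode-encode : ∀ i x → decode (encode i x) ≡ (i , x)
      decode-encode i x = ≡.trans
        (cong (map₂ (tabulate ∘ finToFun)) (remQuot-combine i (funToFin (lookup x))))
        (cong (i ,_) (≡.trans (tabulate-cong (finToFun-funToFin (lookup x))) (tabulate∘lookup x)))

      -- Picks the factor that does not depend on `rep J`. The weights are found before the place
      -- `s₀` of the point mass, so what they kill must not depend on that place.
      far : Fin r → Bool
      far i = not (side (t i) (rep J))

      module _ (us : Weights others) (s₀ : Fin m) (one : OneAt s₀ us)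
        (kills : ∀ i x j → j ∈ₗ others → side (t i) j ≡ far i →
                 factor (contractTerm us (t i)) (far i) (Vec.map ι x) ≈ 0#) where

        φ : Vec (Fin m′) d → Vec (Fin m) d
        φ x = Vec.map ι x [ rep J ]≔ s₀

        φ-local : Coordinatewise φ
        φ-local x y j x≡y = lookup-update-cong {x = Vec.map ι x} {y = Vec.map ι y} (rep J) s₀ j
          (≡.trans (lookup-map j ι x) (≡.trans (cong ι x≡y) (≡.sym (lookup-map j ι y))))

        t′ : Fin r → Term d m′
        t′ i = comapTerm φ φ-local (contractTerm us (t i))

        -- While `φ` pins only `rep J`, here all of `J` is set to `s₀`; this is where `f` is
        -- evaluated once the sums have collapsed.
        ψ : Vec (Fin m′) d → Vec (Fin m) d
        ψ x = setAll others s₀ (φ x)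

        φ-rep : ∀ x → lookup (φ x) (rep J) ≡ s₀
        φ-rep x = lookup∘update (rep J) (Vec.map ι x) s₀

        ψ-inside : ∀ {j} x → π j ≡ J → lookup (ψ x) j ≡ s₀
        ψ-inside {j} x πj≡J with j ≟ rep J
        ... | yes ≡.refl = ≡.trans (lookup-setAll-∉ rep∉others) (φ-rep x)
        ... | no j≢      = lookup-setAll-∈ (∈-others πj≡J j≢)

        ψ-outside : ∀ {j} x → π j ≢ J → lookup (ψ x) j ≡ ι (lookup x j)
        ψ-outside {j} x πj≢J = ≡.trans (lookup-setAll-∉ (∉-others πj≢J))
          (≡.trans (lookup∘update′ (λ { ≡.refl → πj≢J (π-rep J) }) (Vec.map ι x) s₀) (lookup-map j ι x))

        ∈⇒≢J : ∀ {K} → K ∈ₗ Js → K ≢ J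
        ∈⇒≢J K∈ ≡.refl = J∉Js K∈

        ψ-rep : ∀ {j} x → π j ≢ J → lookup (ψ x) (rep (π j)) ≡ ι (lookup x (rep (π j)))
        ψ-rep {j} x πj≢J = ψ-outside x (πj≢J ∘ ≡.trans (≡.sym (π-rep (π j))))

        off′ : VanishesOffDiagonal Js (f ∘ ψ)
        off′ x j πj∈ x≢ = off (ψ x) j (there πj∈) λ ψ≡ → x≢ (inject≤-injective m′≤m m′≤m _ _
          (≡.trans (≡.sym (ψ-outside x πj≢J)) (≡.trans ψ≡ (ψ-rep x πj≢J))))
          where
          πj≢J : π j ≢ J
          πj≢J = ∈⇒≢J πj∈

        on′ : OneOnDiagonal Js (f ∘ ψ)
        on′ x x≡ = on (ψ x) λ where
          j (here πj≡J) → ≡.trans (ψ-inside x πj≡J) (≡.sym (ψ-inside x (≡.trans (π-rep (π j)) πj≡J)))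
          j (there πj∈) → ≡.trans (ψ-outside x (∈⇒≢J πj∈))
            (≡.trans (cong ι (x≡ j πj∈)) (≡.sym (ψ-rep x (∈⇒≢J πj∈))))

        -- Both sides of `f≈` are contracted with `us`: the left collapses on the diagonal, the
        -- right is linear.
        f′≈ : ∀ x → f (ψ x) ≈ sum λ i → value (t′ i) x
        f′≈ x = begin
          f (ψ x)
            ≈⟨ contract-diagonal us (Unique.filter⁺ _ (Unique.allFin⁺ d)) rep∉others one vanish (φ x) (φ-rep x) ⟨
          contract us f (φ x)
            ≈⟨ contract-cong′ us f≈ (φ x) ⟩
          contract us (λ y → sum λ i → value (t i) y) (φ x)
            ≈⟨ contract-sum us (value ∘ t) (φ x) ⟩
          sum (λ i → contract us (value (t i)) (φ x))
            ≈⟨ sum-cong-≋ (λ i → contract-value us (t i) (φ x)) ⟩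
          sum (λ i → value (t′ i) x) ∎
          where
          vanish : ∀ y j → j ∈ₗ others → lookup y (rep J) ≡ s₀ → lookup y j ≢ s₀ → f y ≈ 0#
          vanish y j j∈ y₀≡ y≢ =
            let (_ , πj≡J , _) = ∈-filter⁻ _ {xs = allFin d} j∈ in
            off y j (here πj≡J) λ yj≡ → y≢ (≡.trans yj≡ (≡.trans (cong (lookup y ∘ rep) πj≡J) y₀≡))

        split′ : ∀ i → DeadOrSplit Js (t′ i)
        split′ i with split i
        ... | inj₁ dead = inj₁ λ x → begin
          value (t′ i) x                 ≈⟨ contract-value us (t i) (φ x) ⟨
          contract us (value (t i)) (φ x) ≈⟨ contract-cong′ us dead (φ x) ⟩
          contract us (λ _ → 0#) (φ x)   ≈⟨ contract-zero us (φ x) ⟩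
          0#                             ∎
        ... | inj₂ (there later) = inj₂ (Any.map
          (λ {K} (splits : Splits (t i) K) b → let (j , πj≡ , side≡) = splits b in
            j , πj≡ , ≡.trans (cong (λ σ → σ j) (side-contractTerm us (t i))) side≡) later)
        -- Some coordinate of `J` lies on the side opposite to `rep J`, hence in `others`. So the
        -- far factor is killed at the grid point, and pinning `rep J` does not alter it.
        ... | inj₂ (here splits) =
          let (j , πj≡J , side≡) = splits (far i) in
          inj₁ λ x → value-zero (t′ i) (far i) {x} (trans
            (local (contractTerm us (t i)) (far i) λ k side≡′ →
              lookup∘update′ (λ { ≡.refl → not-¬ ≡.refl
                (≡.trans (≡.sym (cong (λ σ → σ k) (side-contractTerm us (t i)))) side≡′) }) (Vec.map ι x) s₀)
            (kills i x j (∈-others πj≡J λ j≡rep → not-¬ (cong (side (t i)) j≡rep) side≡) side≡))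

      step : (∀ {f′ : Vec (Fin m′) d → Carrier} (t′ : Fin r → Term d m′) →
          VanishesOffDiagonal Js f′ → OneOnDiagonal Js f′ →
          (∀ x → f′ x ≈ sum λ i → value (t′ i) x) → (∀ i → DeadOrSplit Js (t′ i)) → ⊥) → ⊥
      step rest = killing-weights others (t ∘ proj₁ ∘ decode) (far ∘ proj₁ ∘ decode) (Vec.map ι ∘ proj₂ ∘ decode)
        λ (us , pivots , ≤pivots , one , kills) →
        -- Any point off the pivots of all weights will do for the point mass.
        let (s₀ , s₀∉) = ∃∉ pivots (ℕ.≤-<-trans ≤pivots
              (ℕ.≤-<-trans (ℕ.*-monoˡ-≤ (r * m′ ^ d) length-others) large))
            kills′ : ∀ i x j → j ∈ₗ others → side (t i) j ≡ far i →
                     factor (contractTerm us (t i)) (far i) (Vec.map ι x) ≈ 0#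
            kills′ i x = subst (λ (i , x) → ∀ j → j ∈ₗ others → side (t i) j ≡ far i →
                     factor (contractTerm us (t i)) (far i) (Vec.map ι x) ≈ 0#) (decode-encode i x) (kills (encode i x))
        in rest (t′ us s₀ (one s₀ s₀∉) kills′) (off′ us s₀ (one s₀ s₀∉) kills′) (on′ us s₀ (one s₀ s₀∉) kills′)
             (f′≈ us s₀ (one s₀ s₀∉) kills′) (split′ us s₀ (one s₀ s₀∉) kills′)

    -- The lower bound on the number of terms.

    no-decomposition : ∀ {r} → 2 ≤ r → ∀ Js → Unique Js → ∀ {m} → gridSize d r (length Js) ≤ m →
      ∀ {f : Vec (Fin m) d → Carrier} (t : Fin r → Term d m) →
      VanishesOffDiagonal Js f → OneOnDiagonal Js f →
      (∀ x → f x ≈ sum λ i → value (t i) x) → (∀ i → DeadOrSplit Js (t i)) → ⊥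
    no-decomposition {suc r-1} 2≤r [] _ {zero} large = contradiction large (ℕ.<⇒≱ (ℕ.m^n>0 (suc r-1) (suc d ^ 1)))
    -- With no block left, all terms are dead while the condition for value 1 is vacuous; a nonempty
    -- grid supplies a point to compare at.
    no-decomposition 2≤r [] _ {suc m} large {f} t off on f≈ split = 0≉1 (begin
      0#                          ≈⟨ sum-zero dead ⟨
      sum (λ i → value (t i) x₀)  ≈⟨ f≈ x₀ ⟨
      f x₀                        ≈⟨ on x₀ (λ _ ()) ⟩
      1#                          ∎)
      where
      x₀ : Vec (Fin (suc m)) d
      x₀ = replicate d zero
      dead : ∀ i → value (t i) x₀ ≈ 0#
      dead i with split i
      ... | inj₁ dead = dead x₀
      ... | inj₂ ()
    no-decomposition {suc r-1} 2≤r (J ∷ Js) (J∉ ∷ unique) large t off on f≈ split =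
      Step.step (ℕ.≤-trans (gridSize-mono d (length Js)) large)
        (ℕ.<-≤-trans (gridSize-suc d 2≤r (length Js)) large)
        (λ J∈ → All.lookup J∉ J∈ ≡.refl) t off on f≈ split
        (no-decomposition 2≤r Js unique ℕ.≤-refl)

    -- For a single term the grid sizes do not grow, so another argument is used. The values at two
    -- constant points have product 1, but exchanging factors exhibits in this product the value at
    -- a mixed point, which is off the diagonal.
    one-term : ∀ {m} {f : Vec (Fin (2 + m)) d → Carrier} (t : Term d (2 + m)) →
      VanishesOffDiagonal (allFin s) f → OneOnDiagonal (allFin s) f →
      (∀ x → f x ≈ value t x) → ¬ ∃ (Splits t)
    one-term {m} {f} t off on f≈ (J , splits) = 0≉1 (sym (begin
      1#                     ≈⟨ *-identityˡ 1# ⟨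
      1# ⊛ 1#                ≈⟨ *-cong (constant zero) (constant (suc zero)) ⟨
      (a₀ ⊛ b₀) ⊛ (a₁ ⊛ b₁)  ≈⟨ *-congˡ (*-comm a₁ b₁) ⟩
      (a₀ ⊛ b₀) ⊛ (b₁ ⊛ a₁)  ≈⟨ *-assoc a₀ b₀ (b₁ ⊛ a₁) ⟩
      a₀ ⊛ (b₀ ⊛ (b₁ ⊛ a₁))  ≈⟨ *-congˡ (trans (*-comm _ _) (*-assoc b₁ a₁ b₀)) ⟩
      a₀ ⊛ (b₁ ⊛ (a₁ ⊛ b₀))  ≈⟨ *-assoc a₀ b₁ (a₁ ⊛ b₀) ⟨
      (a₀ ⊛ b₁) ⊛ (a₁ ⊛ b₀)  ≈⟨ *-congʳ mixed-zero ⟩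
      0# ⊛ (a₁ ⊛ b₀)         ≈⟨ zeroˡ _ ⟩
      0#                     ∎))
      where
      const : Fin (2 + m) → Vec (Fin (2 + m)) d
      const = replicate d
      a₀ a₁ b₀ b₁ : Carrier
      a₀ = factor t true  (const zero)
      a₁ = factor t true  (const (suc zero))
      b₀ = factor t false (const zero)
      b₁ = factor t false (const (suc zero))
      constant : ∀ i → factor t true (const i) ⊛ factor t false (const i) ≈ 1#
      constant i = trans (sym (f≈ (const i)))
        (on (const i) λ j _ → ≡.trans (lookup-replicate j i) (≡.sym (lookup-replicate (rep (π j)) i)))
      bit : Bool → Fin (2 + m)
      bit b = if b then zero else suc zero
      bit-injective : ∀ {b b′} → bit b ≡ bit b′ → b ≡ b′
      bit-injective {false} {false} _ = ≡.refl
      bit-injective {true}  {true}  _ = ≡.refl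
      mixed : Vec (Fin (2 + m)) d
      mixed = tabulate (bit ∘ side t)
      mixed-local : ∀ b → factor t b mixed ≈ factor t b (const (bit b))
      mixed-local b = local t b λ j side≡ → ≡.trans (lookup∘tabulate (bit ∘ side t) j)
        (≡.trans (cong bit side≡) (≡.sym (lookup-replicate j (bit b))))
      mixed-zero : a₀ ⊛ b₁ ≈ 0#
      mixed-zero =
        -- This coordinate of `J` is on the other side from `rep J`, so `mixed` differs at the two.
        let (j , πj≡J , side≡) = splits (not (side t (rep J))) in
        trans (sym (*-cong (mixed-local true) (mixed-local false))) (trans (sym (f≈ mixed))
          (off mixed j (∈-allFin _) λ bits≡ → not-¬ ≡.refl (≡.trans (bit-injective (≡.trans
            (≡.sym (lookup∘tabulate (bit ∘ side t) (rep J)))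
            (≡.trans (≡.trans (cong (lookup mixed ∘ rep) (≡.sym πj≡J)) (≡.sym bits≡))
              (lookup∘tabulate (bit ∘ side t) j)))) side≡)))

    length-lower-bound : 2 ≤ d → ∀ {n} .{{_ : NonZero n}} {r} {f : Vec (Fin n) d → Carrier} (t : Fin r → Term d n) →
      VanishesOffDiagonal (allFin s) f → OneOnDiagonal (allFin s) f →
      (∀ x → f x ≈ sum λ i → value (t i) x) → (∀ i → ∃ (Splits (t i))) → n ≤ r ^ (3 ^ (2 ^ (d + 1)))
    -- The empty sum is 0, but the value at a constant point is 1.
    length-lower-bound 2≤d {suc n} {0} t off on f≈ splits = ⊥-elim (0≉1
      (trans (sym (f≈ (replicate d zero))) (on (replicate d zero) λ j _ →
        ≡.trans (lookup-replicate j zero) (≡.sym (lookup-replicate (rep (π j)) zero)))))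
    length-lower-bound 2≤d {1} {1} t off on f≈ splits = ℕ.m^n>0 1 (3 ^ (2 ^ (d + 1)))
    length-lower-bound 2≤d {suc (suc n)} {1} t off on f≈ splits =
      ⊥-elim (one-term (t zero) off on (λ x → trans (f≈ x) (+-identityʳ _)) (splits zero))
    length-lower-bound 2≤d {n} {r@(suc (suc _))} t off on f≈ splits = ℕ.≮⇒≥ λ bound<n →
      no-decomposition (s≤s (s≤s z≤n)) (allFin s) (Unique.allFin⁺ s)
        (ℕ.≤-trans size≤bound (ℕ.<⇒≤ bound<n)) t off on f≈
        (λ i → let (J , split) = splits i in inj₂ (lose (∈-allFin J) split))
      where
      s≤d : s ≤ d
      s≤d = injective⇒≤ {f = rep} λ {J} {K} eq →
        ≡.trans (≡.sym (π-rep J)) (≡.trans (cong π eq) (π-rep K))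
      -- At most `d` blocks are contracted, so the exponent is at most `suc d ^ suc d`.
      size≤bound : gridSize d r (length (allFin s)) ≤ r ^ (3 ^ (2 ^ (d + 1)))
      size≤bound = ℕ.^-monoʳ-≤ r (ℕ.≤-trans
        (ℕ.^-monoʳ-≤ (suc d) (s≤s (ℕ.≤-trans (ℕ.≤-reflexive (length-tabulate id)) s≤d)))
        (exponent-bound 2≤d))

-- Points as vectors, and the blocks of a partition.

AgreeOn : ∀ {a} {A : Set a} {d} → Subset d → Vec A d → Vec A d → Set a
AgreeOn J x y = ∀ {j} → j ∈ˢ J → lookup x j ≡ lookup y j

-- Vectors allow updating a coordinate by its index; tensors are evaluated on them through this map.
toPoint : ∀ {d n} → Vec (Fin n) d → Point {d} (λ _ → n)
toPoint []      = []
toPoint (i ∷ x) = i ∷ toPoint x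

restrict-cong : ∀ {d n} (J : Subset d) {x y : Vec (Fin n) d} → AgreeOn J x y →
  restrict J (toPoint x) ≡ restrict J (toPoint y)
restrict-cong []          {[]}    {[]}    agree = ≡.refl
restrict-cong (true ∷ J)  {i ∷ x} {k ∷ y} agree = ≡.cong₂ _∷_ (agree here) (restrict-cong J (agree ∘ there))
restrict-cong (false ∷ J) {i ∷ x} {k ∷ y} agree = cong skip (restrict-cong J (agree ∘ there))

∈-coordinates : ∀ {d n} {J : Subset d} (x : Vec (Fin n) d) {j} → j ∈ˢ J →
  lookup x j ∈ₗ coordinates (restrict J (toPoint x))
∈-coordinates {J = true ∷ J}  (i ∷ x) here       = here ≡.refl
∈-coordinates {J = true ∷ J}  (i ∷ x) (there j∈) = there (∈-coordinates x j∈)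
∈-coordinates {J = false ∷ J} (i ∷ x) (there j∈) = ∈-coordinates x j∈

coordinates-all : ∀ {d n p} {S : Pred (Fin n) p} (J : Subset d) (x : Vec (Fin n) d) →
  (∀ {j} → j ∈ˢ J → S (lookup x j)) → All S (coordinates (restrict J (toPoint x)))
coordinates-all []          []      all = []
coordinates-all (true ∷ J)  (i ∷ x) all = all here ∷ coordinates-all J x (all ∘ there)
coordinates-all (false ∷ J) (i ∷ x) all = coordinates-all J x (all ∘ there)

Disjoint : ∀ {d} → List (Subset d) → Set
Disjoint = AllPairs λ J₁ J₂ → Empty (J₁ ∩ J₂)

block-unique : ∀ {d} {Bs : List (Subset d)} → Disjoint Bs → ∀ {j} K K′ →
  j ∈ˢ List.lookup Bs K → j ∈ˢ List.lookup Bs K′ → K ≡ K′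
block-unique (disj ∷ _) zero    zero     j∈ j∈′ = ≡.refl
block-unique (disj ∷ _) zero    (suc K′) j∈ j∈′ =
  contradiction (_ , x∈p∩q⁺ (j∈ , j∈′)) (All.lookup disj (∈-lookup K′))
block-unique (disj ∷ _) (suc K) zero     j∈ j∈′ =
  contradiction (_ , x∈p∩q⁺ (j∈′ , j∈)) (All.lookup disj (∈-lookup K))
block-unique (_ ∷ disj) (suc K) (suc K′) j∈ j∈′ = cong suc (block-unique disj K K′ j∈ j∈′)

∉⇒lookup≡false : ∀ {d} {J : Subset d} {j} → ¬ j ∈ˢ J → lookup J j ≡ false
∉⇒lookup≡false j∉ = ¬-not (j∉ ∘ lookup⇒[]= _ _)

∃-⊈ : ∀ {d} {J K : Subset d} → ¬ J ⊆ K → ∃[ j ] j ∈ˢ J × ¬ j ∈ˢ K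
∃-⊈ {d} {J} {K} J⊈K =
  let (j , ¬j∈⇒) = ¬∀⟶∃¬ d _ (λ j → (j ∈? J) →-dec (j ∈? K)) (λ J⊆K → J⊈K (J⊆K _)) in
  j , decidable-stable (j ∈? J) (λ j∉J → ¬j∈⇒ λ j∈J → contradiction j∈J j∉J) , λ j∈K → ¬j∈⇒ λ _ → j∈K

module _ {d : ℕ} (P : Partition d) where

  count : ℕ
  count = length (blocks P)

  block : Fin count → Subset d
  block = List.lookup (blocks P)

  blockOf : Fin d → Fin count
  blockOf j = Any.index (covering P j)

  ∈-blockOf : ∀ j → j ∈ˢ block (blockOf j)
  ∈-blockOf j = Any.lookup-index (covering P j)

  blockOf-unique : ∀ {j K} → j ∈ˢ block K → blockOf j ≡ K
  blockOf-unique {j} j∈ = block-unique (disjoint P) _ _ (∈-blockOf j) j∈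

  representative : Fin count → Fin d
  representative K = proj₁ (All.lookup (nonempty P) (∈-lookup K))

  representative-∈ : ∀ K → representative K ∈ˢ block K
  representative-∈ K = proj₂ (All.lookup (nonempty P) (∈-lookup K))

  blockOf-representative : ∀ K → blockOf (representative K) ≡ K
  blockOf-representative K = blockOf-unique (representative-∈ K)

  -- Some block `K` of `P` lies in no block of `Q`. The block `J` of `Q` through the representative
  -- of `K` meets `K` without containing it.
  splitting-block : ∀ {Q} → ¬ P ≺ Q → ∃₂ λ K J → J ∈ₗ blocks Q ×
    (∃[ j ] j ∈ˢ block K × j ∈ˢ J) × (∃[ j ] j ∈ˢ block K × ¬ j ∈ˢ J)
  splitting-block {Q} P⊀Q =
    let coarse = ¬All⇒Any¬ (λ J → Any.any? (J ⊆?_) (blocks Q)) (blocks P) P⊀Q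
        K      = Any.index coarse
        (J , J∈ , rep∈J) = find (covering Q (representative K))
    in K , J , J∈ , (representative K , representative-∈ K , rep∈J) ,
       ∃-⊈ λ K⊆J → Any.lookup-index coarse (lose J∈ K⊆J)

-- Translation of `Δ` and of tensors of R-rank at most 1 to vectors.

module _ {c ℓ₁ ℓ₂ : Level} (𝔽 : HeytingField c ℓ₁ ℓ₂) where

  open HeytingField 𝔽 using (heytingCommutativeRing)
  open HeytingCommutativeRing heytingCommutativeRing using (commutativeRing)
  open CommutativeRing commutativeRing hiding (zero; _+_; _*_)
  open CommutativeRing commutativeRing using () renaming (_*_ to _⊛_)
  open import Relation.Binary.Reasoning.Setoid setoid

  product-one : ∀ {a} {A : Set a} (g : A → Carrier) Bs → (∀ {B} → B ∈ₗ Bs → g B ≈ 1#) → product 𝔽 (map g Bs) ≈ 1#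
  product-one g []       g≈1 = refl
  product-one g (B ∷ Bs) g≈1 =
    trans (*-cong (g≈1 (here ≡.refl)) (product-one g Bs (g≈1 ∘ there))) (*-identityˡ 1#)

  product-zero : ∀ {a} {A : Set a} (g : A → Carrier) {Bs B} → B ∈ₗ Bs → g B ≈ 0# → product 𝔽 (map g Bs) ≈ 0#
  product-zero g (here ≡.refl) g≈0 = trans (*-congʳ g≈0) (zeroˡ _)
  product-zero g (there B∈)    g≈0 = trans (*-congˡ (product-zero g B∈ g≈0)) (zeroʳ _)

  ΔBlock-one : ∀ {d n} (J : Subset d) (x : Vec (Fin n) d) →
    (∀ {j k} → j ∈ˢ J → k ∈ˢ J → lookup x j ≡ lookup x k) → ΔBlock 𝔽 J (restrict J (toPoint x)) ≈ 1#
  ΔBlock-one J x eq with allEqual? (coordinates (restrict J (toPoint x)))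
  ... | yes _     = refl
  ... | no ¬equal = contradiction (coordinates-all J x λ j∈ → coordinates-all J x (eq j∈)) ¬equal

  ΔBlock-zero : ∀ {d n} (J : Subset d) (x : Vec (Fin n) d) {j k} →
    j ∈ˢ J → k ∈ˢ J → lookup x j ≢ lookup x k → ΔBlock 𝔽 J (restrict J (toPoint x)) ≈ 0#
  ΔBlock-zero J x j∈ k∈ x≢ with allEqual? (coordinates (restrict J (toPoint x)))
  ... | yes equal = contradiction (All.lookup (All.lookup equal (∈-coordinates x j∈)) (∈-coordinates x k∈)) x≢
  ... | no _      = refl

  module _ {d n : ℕ} where

    Factors : List (Subset d) → Set c
    Factors = All λ J → Box (λ _ → n) J → Carrier

    productAt : ∀ {Bs} → Factors Bs → Vec (Fin n) d → Carrier
    productAt a x = product 𝔽 (All.reduce (λ {J} aJ → aJ (restrict J (toPoint x))) a)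

    factorAt : ∀ {Bs J} → Factors Bs → J ∈ₗ Bs → Vec (Fin n) d → Carrier
    factorAt {J = J} a J∈ x = All.lookup a J∈ (restrict J (toPoint x))

    cofactorAt : ∀ {Bs J} → Factors Bs → J ∈ₗ Bs → Vec (Fin n) d → Carrier
    cofactorAt (_ ∷ a)        (here ≡.refl) x = productAt a x
    cofactorAt (_∷_ {K} aK a) (there J∈)    x = aK (restrict K (toPoint x)) ⊛ cofactorAt a J∈ x

    productAt-split : ∀ {Bs J} (a : Factors Bs) (J∈ : J ∈ₗ Bs) x → productAt a x ≈ factorAt a J∈ x ⊛ cofactorAt a J∈ x
    productAt-split (_ ∷ a) (here ≡.refl) x = refl
    productAt-split (_ ∷ a) (there J∈)    x = trans (*-congˡ (productAt-split a J∈ x))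
      (trans (sym (*-assoc _ _ _)) (trans (*-congʳ (*-comm _ _)) (*-assoc _ _ _)))

    restrict-disjoint : ∀ {J K : Subset d} {x y : Vec (Fin n) d} → Empty (K ∩ J) → (∀ {j} → ¬ j ∈ˢ J → lookup x j ≡ lookup y j) →
      restrict K (toPoint x) ≡ restrict K (toPoint y)
    restrict-disjoint {K = K} disj agree =
      restrict-cong K λ j∈K → agree λ j∈J → disj (_ , x∈p∩q⁺ (j∈K , j∈J))

    productAt-cong : ∀ {Bs} (a : Factors Bs) {x y} →
      All (λ K → restrict K (toPoint x) ≡ restrict K (toPoint y)) Bs → productAt a x ≈ productAt a y
    productAt-cong []       []         = refl
    productAt-cong (aK ∷ a) (eq ∷ eqs) = *-cong (reflexive (cong aK eq)) (productAt-cong a eqs)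

    -- All other blocks are disjoint from `J`, so none of the remaining factors sees a coordinate in
    -- `J`.
    cofactorAt-cong : ∀ {Bs J} (a : Factors Bs) → Disjoint Bs → (J∈ : J ∈ₗ Bs) → ∀ {x y} →
      (∀ {j} → ¬ j ∈ˢ J → lookup x j ≡ lookup y j) → cofactorAt a J∈ x ≈ cofactorAt a J∈ y
    cofactorAt-cong (_ ∷ a)  (disj ∷ _) (here ≡.refl) {x} {y} agree = productAt-cong a
      (All.map (λ {K} empty → restrict-disjoint {K = K} {x} {y} (λ (j , j∈) → empty (j , ∩-swap j∈)) agree) disj)
      where
      ∩-swap : ∀ {J K : Subset d} {j} → j ∈ˢ K ∩ J → j ∈ˢ J ∩ K
      ∩-swap {J} {K} j∈ = let (j∈K , j∈J) = x∈p∩q⁻ K J j∈ in x∈p∩q⁺ (j∈J , j∈K)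
    cofactorAt-cong (_∷_ {K} aK a) (disj ∷ disjs) (there J∈) {x} {y} agree = *-cong
      (reflexive (cong aK (restrict-disjoint {K = K} {x} {y} (All.lookup disj J∈) agree))) (cofactorAt-cong a disjs J∈ agree)

    -- One block against the product of all others. A `Subset` is a vector of Booleans, so `J`
    -- itself tells the sides.
    blockTerm : ∀ {Bs J} → Factors Bs → Disjoint Bs → J ∈ₗ Bs → Term 𝔽 d n
    blockTerm {J = J} a disj J∈ = record
      { side   = lookup J
      ; factor = λ b x → if b then factorAt a J∈ x else cofactorAt a J∈ x
      ; local  = λ where
          true  {x} {y} agree → reflexive (cong (All.lookup a J∈) (restrict-cong J λ j∈ → agree _ ([]=⇒lookup j∈)))
          false {x} {y} agree → cofactorAt-cong a disj J∈ λ j∉ → agree _ (∉⇒lookup≡false j∉)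
      }

  module _ {d : ℕ} (P : Partition d) where

    -- One zero factor suffices: that of the block containing both `j` and its representative.
    Δ-vanishes : ∀ {n} → VanishesOffDiagonal 𝔽 (blockOf P) (representative P) (blockOf-representative P) (allFin (count P)) (Δ 𝔽 P n ∘ toPoint)
    Δ-vanishes x j _ x≢ = product-zero (λ J → ΔBlock 𝔽 J (restrict J (toPoint x))) {blocks P} (∈-lookup (blockOf P j))
      (ΔBlock-zero (block P (blockOf P j)) x (∈-blockOf P j) (representative-∈ P (blockOf P j)) x≢)

    Δ-one : ∀ {n} → OneOnDiagonal 𝔽 (blockOf P) (representative P) (blockOf-representative P) (allFin (count P)) (Δ 𝔽 P n ∘ toPoint)
    Δ-one x x≡ = product-one (λ J → ΔBlock 𝔽 J (restrict J (toPoint x))) (blocks P) λ {J} J∈ → ΔBlock-one J x λ j∈ k∈ →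
      ≡.trans (to-rep J∈ j∈) (≡.sym (to-rep J∈ k∈))
      where
      to-rep : ∀ {J} (J∈ : J ∈ₗ blocks P) {j} → j ∈ˢ J → lookup x j ≡ lookup x (representative P (Any.index J∈))
      to-rep J∈ {j} j∈ = ≡.trans (x≡ j (∈-allFin _)) (cong (lookup x ∘ representative P)
        (blockOf-unique P (subst (j ∈ˢ_) (Any.lookup-index J∈) j∈)))

    -- The factor of the block `J` of `Q` found by `splitting-block` is set against the rest; the
    -- block `K` of `P` has coordinates both in `J` and outside it.
    toTerm : ∀ {ρ} {R : Pred (Partition d) ρ} {n} → (∀ Q → Q ∈ R → ¬ (P ≺ Q)) →
      ∀ {T : Tensor 𝔽 {d} (λ _ → n)} → RRank≤1 𝔽 R T →
      Σ[ t ∈ Term 𝔽 d n ] (∀ x → T (toPoint x) ≈ Term.value t x) ×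
        ∃ (Splits 𝔽 (blockOf P) (representative P) (blockOf-representative P) t)
    toTerm P⊀ (Q , Q∈R , a , T≈) =
      let (K , J , J∈ , (j , j∈K , j∈J) , (k , k∈K , k∉J)) = splitting-block P {Q} (P⊀ Q Q∈R) in
      blockTerm a (disjoint Q) J∈ ,
      (λ x → trans (T≈ (toPoint x)) (productAt-split a J∈ x)) ,
      K , λ where
        true  → j , blockOf-unique P j∈K , []=⇒lookup j∈J
        false → k , blockOf-unique P k∈K , ∉⇒lookup≡false k∉J

-- The inequality is the lower bound on the rank raised to the power 1 / c(d) = 3 ^ (2 ^ (d + 1)),
-- which avoids fractional exponents.
theorem1p4 : ∀ {ρ c ℓ₁ ℓ₂ : Level} (d : ℕ) → 2 ≤ d →
    (P : Partition d) (R : Pred (Partition d) ρ) → Satisfiable R →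
    (∀ Q → Q ∈ R → ¬ (P ≺ Q)) →
    (𝔽 : HeytingField c ℓ₁ ℓ₂) (n : ℕ) → .{{_ : NonZero n}} →
    (r : ℕ) → IsRRank 𝔽 R (Δ 𝔽 P n) r →
    n ≤ r ^ (3 ^ (2 ^ (d + 1)))
theorem1p4 d 2≤d P R _ P⊀ 𝔽 n r ((T , T≤1 , Δ≈) , _) =
  length-lower-bound 𝔽 (blockOf P) (representative P) (blockOf-representative P) 2≤d
    (λ i → proj₁ (term i)) (Δ-vanishes 𝔽 P) (Δ-one 𝔽 P)
    (λ x → trans (Δ≈ (toPoint x)) (sum-cong-≋ λ i → proj₁ (proj₂ (term i)) x))
    (λ i → proj₂ (proj₂ (term i)))
  where
  open HeytingField 𝔽 using (heytingCommutativeRing)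
  open HeytingCommutativeRing heytingCommutativeRing using (commutativeRing)
  open CommutativeRing commutativeRing using (trans; +-commutativeMonoid)
  open import Algebra.Properties.CommutativeMonoid.Sum +-commutativeMonoid using (sum-cong-≋)
  term : ∀ i → _
  term i = toTerm 𝔽 P P⊀ (T≤1 i)
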